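{- There exists a sentence $\psi$ of the logic ${\cal R}ing(0,+,*,<)$ such that its prime spectrum $Sp(\psi)$ has no natural density, i.e. the limit $\lim_{n\to\infty}\pi_{Sp(\psi)}(n)/\pi(n)$ does not exist.
   Context: For an integer $m\ge 1$, $\mathbb{Z}_m$ denotes the finite residue class ring with universe $\{0,1,\ldots,m-1\}$, addition and multiplication modulo $m$. The logic ${\cal R}ing(0,+,*)$ is the set of first-order sentences over the vocabulary consisting of a constant symbol $0$ and binary function symbols $+$ and $*$; its models are the rings $\mathbb{Z}_m$, with $0$ interpreted as the residue class $0$ and $+,*$ as addition and multiplication mod $m$. The logic ${\cal R}ing(0,+,*,<)$ additionally has a binary relation symbol $<$, interpreted in $\mathbb{Z}_m$ as the natural order of the representatives $0<1<\cdots<m-1$. The prime spectrum of a sentence $\sigma$ is $Sp(\sigma)=\{p \text{ prime} : \mathbb{Z}_p\models\sigma\}$. For a real $x>0$, $\pi(x)$ is the number of primes $\le x$, and for a set $S$ of primes, $\pi_S(x)=|\{q\in S: q\le x\}|$. A set $S$ of primes has natural density if $\lim_{n\to\infty}\pi_S(n)/\pi(n)$ (over natural numbers $n$) exists. -}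

module Defs where

open import Data.Nat using (ℕ; zero; suc; _+_; _*_; _<ᵇ_; _≤_; NonZero)
open import Data.Nat.DivMod using (_mod_)
open import Data.Nat.Primality using (prime?)
open import Data.Fin using (Fin; toℕ)
open import Data.Fin.Properties using (_≟_)
open import Data.Bool using (Bool; true; false; not; _∧_; _∨_; if_then_else_)
open import Data.List using (List; allFin; upTo; filter; length)
open import Data.Bool.ListAction using (all; any)
open import Data.Integer using (+_)
open import Data.Rational.Unnormalised using (ℚᵘ; mkℚᵘ; 0ℚᵘ; _-_; ∣_∣; _<_)
open import Data.Product using (Σ; _×_)
open import Relation.Nullary.Decidable using (⌊_⌋)

data Term (n : ℕ) : Set where
  var  : Fin n → Term n
  zer  : Term n
  _⊕_  : Term n → Term n → Term n
  _⊛_  : Term n → Term n → Term n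

data Formula : ℕ → Set where
  _≐_   : ∀ {n} → Term n → Term n → Formula n
  _≺_   : ∀ {n} → Term n → Term n → Formula n
  ¬'_   : ∀ {n} → Formula n → Formula n
  _∧'_  : ∀ {n} → Formula n → Formula n → Formula n
  _∨'_  : ∀ {n} → Formula n → Formula n → Formula n
  _⇒'_  : ∀ {n} → Formula n → Formula n → Formula n
  ∀'_   : ∀ {n} → Formula (suc n) → Formula n
  ∃'_   : ∀ {n} → Formula (suc n) → Formula n

Sentence : Set
Sentence = Formula 0

module _ (m : ℕ) .{{_ : NonZero m}} where

  addZ : Fin m → Fin m → Fin m
  addZ a b = (toℕ a + toℕ b) mod m

  mulZ : Fin m → Fin m → Fin m
  mulZ a b = (toℕ a * toℕ b) mod m

  zeroZ : Fin m
  zeroZ = 0 mod m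

  evalT : ∀ {n} → (Fin n → Fin m) → Term n → Fin m
  evalT ρ (var i) = ρ i
  evalT ρ zer     = zeroZ
  evalT ρ (s ⊕ t) = addZ (evalT ρ s) (evalT ρ t)
  evalT ρ (s ⊛ t) = mulZ (evalT ρ s) (evalT ρ t)

  extend : ∀ {n} → (Fin n → Fin m) → Fin m → Fin (suc n) → Fin m
  extend ρ a Fin.zero    = a
  extend ρ a (Fin.suc i) = ρ i

  evalF : ∀ {n} → (Fin n → Fin m) → Formula n → Bool
  evalF ρ (s ≐ t)  = ⌊ evalT ρ s ≟ evalT ρ t ⌋
  evalF ρ (s ≺ t)  = toℕ (evalT ρ s) <ᵇ toℕ (evalT ρ t)
  evalF ρ (¬' φ)   = not (evalF ρ φ)
  evalF ρ (φ ∧' ψ) = evalF ρ φ ∧ evalF ρ ψ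
  evalF ρ (φ ∨' ψ) = evalF ρ φ ∨ evalF ρ ψ
  evalF ρ (φ ⇒' ψ) = not (evalF ρ φ) ∨ evalF ρ ψ
  evalF ρ (∀' φ)   = all (λ a → evalF (extend ρ a) φ) (allFin m)
  evalF ρ (∃' φ)   = any (λ a → evalF (extend ρ a) φ) (allFin m)

  noVars : Fin 0 → Fin m
  noVars ()

  Models : Sentence → Bool
  Models σ = evalF noVars σ

-- Z_m ⊨ σ for arbitrary m (Z_0 is not a model; only used at primes m).
modelsℕ : ℕ → Sentence → Bool
modelsℕ zero    σ = false
modelsℕ (suc k) σ = Models (suc k) σ

isPrime : ℕ → Bool
isPrime p = ⌊ prime? p ⌋

Sp : Sentence → ℕ → Bool
Sp σ q = isPrime q ∧ modelsℕ q σ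

πS : (ℕ → Bool) → ℕ → ℕ
πS S x = length (filter (λ q → S q Data.Bool.≟ true) (upTo (suc x)))

π : ℕ → ℕ
π = πS isPrime

-- the ratio π_S(n)/π(n); for n < 2 (π(n) = 0) an arbitrary value 0 is used,
-- which does not affect existence of the limit.
ratio : (ℕ → Bool) → ℕ → ℚᵘ
ratio S n with π n
... | zero  = 0ℚᵘ
... | suc k = mkℚᵘ (+ πS S n) k

-- The limit lim π_S(n)/π(n) exists (in ℝ): since there are no reals in the
-- library, this is expressed by the rational sequence being Cauchy.
HasNaturalDensity : (ℕ → Bool) → Set
HasNaturalDensity S =
  (ε : ℚᵘ) → 0ℚᵘ < ε →
    Σ ℕ λ N → (m n : ℕ) → N ≤ m → N ≤ n →
      ∣ ratio S m - ratio S n ∣ < ε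

{-# OPTIONS --safe #-}

-- Let A be the set of numbers 2 ^ 3 ^ k, and let ψ say that x < p ≤ x² for some x ∈ A.
-- For x ∈ A all primes of (x, x²] and none of (x², x³] belong to Sp ψ, as the next element
-- of A is x³. Since π (2 ^ t) ≥ 2 ^ (t - 2) / t, both π x / π (x²) and π (x²) / π (x³) are
-- at most 1/3 for large x, so the ratio is at least 2/3 at x² and at most 1/3 at x³.
--
-- The bound on π: a common multiple of 1, …, n of size at most n ^ π n exists, and Leibniz's
-- harmonic triangle shows that it is divisible by a central binomial coefficient.
--
-- A is first-order definable: x is a power of 2 iff its divisors are 1 or even, and for
-- x = 2 ^ n the exponent is a power of 3 iff its divisors are 1 or multiples of 3, where d ∣ n
-- is expressed by 2 ^ d - 1 ∣ 2 ^ n - 1. Divisibility of integers is recovered from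
-- multiplication mod p by checking along the multiples of d that none of them wraps around.
module Submission where

open import Defs
open import Data.Bool using (Bool; true; false; if_then_else_; _∧_)
import Data.Bool as Bool
open import Data.Bool.ListAction using (all; any)
open import Data.Bool.Properties using (∧-conicalˡ; ∧-conicalʳ)
open import Data.Fin using (Fin; zero; suc; toℕ; fromℕ<)
import Data.Fin.Properties as Fin
open import Data.Fin.Properties using (toℕ-fromℕ<; toℕ<n; toℕ-injective)
import Data.Integer as ℤ
import Data.Integer.Properties as ℤ
open import Data.List using (upTo; filter; length; tabulate; []; _∷_; _∷ʳ_; _++_)
open import Data.List.Properties using (upTo-∷ʳ; filter-++; length-++)
open import Data.List.Relation.Unary.All using (_∷_)
open import Data.Nat
open import Data.Nat.Combinatorics using (_C_; nCk+nC[k+1]≡[n+1]C[k+1])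
open import Data.Nat.Coprimality using (Coprime; coprime-divisor)
import Data.Nat.Coprimality as Coprimality
open import Data.Nat.DivMod
  using (_mod_; m≡m%n+[m/n]*n; m%n<n; m%n≤m; n%n≡0; m<n⇒m%n≡m; m≤n⇒[n∸m]%m≡n%m)
open import Data.Nat.Divisibility
open import Data.Nat.Induction using (<-rec)
open import Data.Nat.Primality
open import Data.Nat.Primality.Factorisation using (factorise)
open import Data.Nat.Properties
open import Data.Nat.Tactic.RingSolver using (solve-∀)
open import Data.Product using (Σ; ∃; ∃₂; _×_; _,_)
open import Data.Rational.Unnormalised using (ℚᵘ; mkℚᵘ; *≤*; *<*)
import Data.Rational.Unnormalised as ℚ
import Data.Rational.Unnormalised.Properties as ℚ
open import Data.Sum using (_⊎_; inj₁; inj₂)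
import Data.Sum as Sum
open import Function using (_∘_; id)
open import Relation.Binary.PropositionalEquality
open import Relation.Nullary using (¬_; yes; no; contradiction)
open import Relation.Nullary.Decidable using (toWitness)
open import Relation.Nullary.Reflects
  using (Reflects; ofʸ; ofⁿ; invert; det; ¬-reflects; _×-reflects_; _⊎-reflects_; _→-reflects_)

-- Prime powers, coprimality and integer logarithms

prime⇒2≤ : ∀ {p} → Prime p → 2 ≤ p
prime⇒2≤ pr = nonTrivial⇒n>1 _ {{prime⇒nonTrivial pr}}

factorOut : ∀ {r} → 2 ≤ r → ∀ n → 0 < n → ∃₂ λ e i → n ≡ r ^ e * i × r ∤ i
factorOut {r} 2≤r = <-rec _ step
  where
  step : ∀ n → (∀ {m} → m < n → 0 < m → ∃₂ λ e i → m ≡ r ^ e * i × r ∤ i) →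
         0 < n → ∃₂ λ e i → n ≡ r ^ e * i × r ∤ i
  step n rec n>0 with r ∣? n
  ... | no r∤n = 0 , n , sym (*-identityˡ n) , r∤n
  ... | yes (divides zero refl) = contradiction n>0 λ ()
  ... | yes (divides q@(suc _) refl)
    with e , i , q≡ , r∤i ← rec (m<m*n q r 2≤r) z<s
    = suc e , i , trans (*-comm q r) (trans (cong (r *_) q≡) (sym (*-assoc r (r ^ e) i))) , r∤i

coprime-* : ∀ {a b i} → Coprime a i → Coprime b i → Coprime (a * b) i
coprime-* {a} {b} {i} ca cb {d} (d∣ab , d∣i) =
  cb (coprime-divisor {d} {a} {b} (λ (x∣d , x∣a) → ca (x∣a , ∣-trans x∣d d∣i)) d∣ab , d∣i)

prime⇒coprime-^ : ∀ {r i} → Prime r → r ∤ i → ∀ e → Coprime (r ^ e) i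
prime⇒coprime-^ pr r∤i zero = Coprimality.1-coprimeTo _
prime⇒coprime-^ {r} {i} pr r∤i (suc e) = coprime-* {r} coprime (prime⇒coprime-^ pr r∤i e)
  where
  coprime : Coprime r i
  coprime (d∣r , d∣i) with prime⇒irreducible pr d∣r
  ... | inj₁ d≡1  = d≡1
  ... | inj₂ refl = contradiction d∣i r∤i

coprime⇒*∣ : ∀ {m n N} → Coprime m n → m ∣ N → n ∣ N → m * n ∣ N
coprime⇒*∣ {m} {n} c (divides q refl) n∣qm = subst (_∣ q * m) (*-comm n m)
  (*-monoˡ-∣ m (coprime-divisor {n} {m} {q} (Coprimality.sym c) (subst (n ∣_) (*-comm q m) n∣qm)))

∣prime^⇒prime^ : ∀ {r d} → Prime r → ∀ k → d ∣ r ^ k → ∃ λ j → d ≡ r ^ j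
∣prime^⇒prime^ {r} {d} pr k d∣r^k
  with e , i , d≡ , r∤i ← factorOut (prime⇒2≤ pr) d (n≢0⇒n>0 λ { refl →
         ≢-nonZero⁻¹ (r ^ k) {{m^n≢0 r k {{prime⇒nonZero pr}}}} (0∣⇒≡0 d∣r^k) })
  = e , trans d≡ (trans (cong (r ^ e *_) i≡1) (*-identityʳ _))
  where
  i≡1 : i ≡ 1
  -- The `r`-free part `i` divides `r ^ k` and is coprime to it, so coprimality is applied to the
  -- common divisor `i` itself.
  i≡1 = prime⇒coprime-^ pr r∤i k (∣-trans (divides (r ^ e) d≡) d∣r^k , ∣-refl)

-- What remains of `n` after removing every factor `r` is again a divisor of `n`, and it can only
-- satisfy the hypothesis by being 1. This turns "is a power of `r`" into a condition on divisors,
-- without exponentiation.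
prime^-criterion : ∀ {r n} → Prime r → 0 < n → (∀ d → d ∣ n → d ≡ 1 ⊎ r ∣ d) → ∃ λ k → n ≡ r ^ k
prime^-criterion {r} {n} pr n>0 h
  with e , i , n≡ , r∤i ← factorOut (prime⇒2≤ pr) n n>0
  with h i (divides (r ^ e) n≡)
... | inj₁ refl = e , trans n≡ (*-identityʳ _)
... | inj₂ r∣i  = contradiction r∣i r∤i

^-cancelˡ-≤ : ∀ {m} → 1 < m → ∀ {a b} → m ^ a ≤ m ^ b → a ≤ b
^-cancelˡ-≤ {m} 1<m {a} {b} le = ≮⇒≥ λ b<a → <⇒≱ (^-monoʳ-< m 1<m b<a) le

^-cancelˡ-< : ∀ {m} → 1 < m → ∀ {a b} → m ^ a < m ^ b → a < b
^-cancelˡ-< {m} 1<m {a} {b} lt = ≰⇒> λ b≤a → <⇒≱ lt (^-monoʳ-≤ m {{>-nonZero (<-trans z<s 1<m)}} b≤a)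

^-monoʳ-∣ : ∀ m {a b} → a ≤ b → m ^ a ∣ m ^ b
^-monoʳ-∣ m {a} {b} a≤b = divides (m ^ (b ∸ a))
  (trans (cong (m ^_) (sym (m∸n+n≡m a≤b))) (^-distribˡ-+-* m (b ∸ a) a))

floorLog : ∀ {r} → 2 ≤ r → ∀ n → 0 < n → ∃ λ e → r ^ e ≤ n × n < r ^ suc e
floorLog {r} 2≤r (suc zero) _ = 0 , ≤-refl , subst (1 <_) (sym (*-identityʳ r)) 2≤r
floorLog {r} 2≤r (suc n@(suc _)) _ with floorLog 2≤r n z<s
... | e , lo , hi with suc n <? r ^ suc e
...   | yes lt = e , m≤n⇒m≤1+n lo , lt
...   | no ¬lt = suc e , ≮⇒≥ ¬lt , ≤-<-trans hi (^-monoʳ-< r 2≤r (n<1+n (suc e)))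

-- Counting functions

count : (ℕ → Bool) → ℕ → ℕ
count f zero    = 0
count f (suc n) = (if f n then 1 else 0) + count f n

-- `πS` includes its bound and `count` excludes it, hence the `suc` in every later use of `count`.
πS≡count : ∀ f n → πS f n ≡ count f (suc n)
πS≡count f n = go (suc n)
  where
  P? = λ q → f q Bool.≟ true
  single : ∀ k → length (filter P? (k ∷ [])) ≡ (if f k then 1 else 0)
  single k with f k
  ... | true  = refl
  ... | false = refl
  go : ∀ k → length (filter P? (upTo k)) ≡ count f k
  go zero = refl
  go (suc k) = begin
    length (filter P? (upTo (suc k)))                             ≡⟨ cong (length ∘ filter P?) (upTo-∷ʳ k) ⟨
    length (filter P? (upTo k ∷ʳ k))                              ≡⟨ cong length (filter-++ P? (upTo k) _) ⟩
    length (filter P? (upTo k) ++ filter P? (k ∷ []))   ≡⟨ length-++ (filter P? (upTo k)) ⟩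
    length (filter P? (upTo k)) + length (filter P? (k ∷ []))     ≡⟨ cong₂ _+_ (go k) (single k) ⟩
    count f k + (if f k then 1 else 0)                            ≡⟨ +-comm (count f k) _ ⟩
    count f (suc k)                                               ∎
    where open ≡-Reasoning

-- Used twice with `h` the primes: with `f` the primes and `g = S` on a block contained in `S`, and
-- with `f = S` and `g` constantly false on a gap of `S`.
count-split : ∀ {f g h} a b → a ≤ b →
  (∀ q → f q ≡ true → h q ≡ true) →
  (∀ q → a ≤ q → q < b → f q ≡ true → g q ≡ true) →
  count f b ≤ count h a + count g b
count-split {f} {g} {h} zero zero z≤n f⇒h f⇒g = z≤n
count-split {f} {g} {h} a (suc b) a≤1+b f⇒h f⇒g with m≤n⇒m<n∨m≡n a≤1+b
... | inj₂ refl = ≤-trans (mono (suc b)) (m≤m+n _ _)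
  where
  mono : ∀ n → count f n ≤ count h n
  mono zero = z≤n
  mono (suc n) with f n in fn | h n in hn
  ... | true  | true  = s≤s (mono n)
  ... | true  | false = contradiction (trans (sym hn) (f⇒h n fn)) λ ()
  ... | false | true  = m≤n⇒m≤1+n (mono n)
  ... | false | false = mono n
... | inj₁ (s≤s a≤b)
  with ih ← count-split {f} {g} {h} a b a≤b f⇒h (λ q a≤q q<b → f⇒g q a≤q (m<n⇒m<1+n q<b))
  with f b in fb | g b in gb
... | true  | true  = subst (suc (count f b) ≤_) (sym (+-suc (count h a) (count g b))) (s≤s ih)
... | true  | false = contradiction (trans (sym gb) (f⇒g b a≤b ≤-refl fb)) λ ()
... | false | true  = ≤-trans ih (+-monoʳ-≤ (count h a) (n≤1+n _))
... | false | false = ih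

count-false : ∀ n → count (λ _ → false) n ≡ 0
count-false zero    = refl
count-false (suc n) = count-false n

count-isPrime-≤ : ∀ n → count isPrime (suc n) ≤ n
count-isPrime-≤ zero = z≤n
count-isPrime-≤ (suc n) with isPrime (suc n)
... | true  = s≤s (count-isPrime-≤ n)
... | false = m≤n⇒m≤1+n (count-isPrime-≤ n)

-- Chebyshev's lower bound

-- `N` is the product over the primes `q < b` of the largest power of `q` not exceeding `n`; every
-- factor is at most `n`, which gives the bound.
prime^-commonMultiple : ∀ {n} → 0 < n → ∀ b → ∃ λ N → 0 < N × N ≤ n ^ count isPrime b ×
  (∀ q e → Prime q → q < b → q ^ e ≤ n → q ^ e ∣ N)
prime^-commonMultiple n>0 zero = 1 , ≤-refl , ≤-refl , λ _ _ _ ()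
prime^-commonMultiple {n} n>0 (suc b) with prime^-commonMultiple n>0 b | prime? b
... | N , N>0 , N≤ , h | no ¬pb = N , N>0 , N≤ , λ q e pq q<1+b le → h q e pq
        (≤∧≢⇒< (s≤s⁻¹ q<1+b) λ { refl → ¬pb pq }) le
... | N , N>0 , N≤ , h | yes pb
  with e , lo , hi ← floorLog (prime⇒2≤ pb) n n>0
  = b ^ e * N
  , *-mono-≤ (m^n>0 b {{prime⇒nonZero pb}} e) N>0
  , *-mono-≤ lo N≤
  , h′
  where
  h′ : ∀ q e′ → Prime q → q < suc b → q ^ e′ ≤ n → q ^ e′ ∣ b ^ e * N
  h′ q e′ pq q<1+b le with m<1+n⇒m<n∨m≡n q<1+b
  ... | inj₁ q<b  = ∣n⇒∣m*n (b ^ e) (h q e′ pq q<b le)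
  ... | inj₂ refl = ∣m⇒∣m*n N (^-monoʳ-∣ b {e′} {e} (s≤s⁻¹ (^-cancelˡ-< (prime⇒2≤ pb) (≤-<-trans le hi))))

primeDivisor : ∀ n → 1 < n → ∃ λ q → Prime q × q ∣ n
primeDivisor n 1<n with factorise n {{>-nonZero (<-trans z<s 1<n)}}
... | record { factors = [] ; isFactorisation = eq } = contradiction (sym eq) (<⇒≢ 1<n)
... | record { factors = q ∷ qs ; isFactorisation = eq ; factorsPrime = pq ∷ _ } =
  q , pq , subst (q ∣_) (sym eq) (m∣m*n _)

-- Strong induction on `i`: a prime `q` dividing `i` is split off with its full multiplicity. The
-- prime power divides `N` by construction, the smaller cofactor by induction, and the two are
-- coprime.
commonMultiple : ∀ n → 0 < n → ∃ λ N → 0 < N × N ≤ n ^ count isPrime (suc n) ×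
  (∀ i → 0 < i → i ≤ n → i ∣ N)
commonMultiple n n>0
  with N , N>0 , N≤ , h ← prime^-commonMultiple n>0 (suc n)
  = N , N>0 , N≤ , <-rec _ step
  where
  step : ∀ i → (∀ {j} → j < i → 0 < j → j ≤ n → j ∣ N) → 0 < i → i ≤ n → i ∣ N
  step (suc zero) rec _ _ = 1∣ N
  step i@(suc (suc _)) rec i>0 i≤n
    with q , pq , q∣i ← primeDivisor i (s<s z<s)
    with factorOut (prime⇒2≤ pq) i i>0
  ... | zero , j , i≡ , q∤j = contradiction (subst (q ∣_) (trans i≡ (*-identityˡ j)) q∣i) q∤j
  ... | suc e , zero , i≡ , q∤j = contradiction (q ∣0) q∤j
  ... | suc e , j@(suc _) , i≡ , q∤j = subst (_∣ N) (sym i≡)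
    (coprime⇒*∣ (prime⇒coprime-^ pq q∤j (suc e))
      (h q (suc e) pq (s≤s (≤-trans (∣⇒≤ q∣i) i≤n)) (≤-trans (∣⇒≤ (divides j (trans i≡ (*-comm _ j)))) i≤n))
      (rec j<i z<s (≤-trans (<⇒≤ j<i) i≤n)))
    where
    j<i : j < i
    j<i = subst (j <_) (trans (*-comm j _) (sym i≡))
      (m<m*n j (q ^ suc e) (<-≤-trans (prime⇒2≤ pq) (m≤m*n q (q ^ e) {{m^n≢0 q e {{prime⇒nonZero pq}}}})))

absorption : ∀ n k → suc k * (suc n C suc k) ≡ suc n * (n C k)
absorption zero zero = refl
absorption zero (suc k) = *-zeroʳ (suc (suc k))
absorption (suc n) zero = begin
  1 * (suc (suc n) C 1)           ≡⟨ *-identityˡ _ ⟩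
  suc (suc n) C 1                 ≡⟨ nCk+nC[k+1]≡[n+1]C[k+1] (suc n) 0 ⟨
  1 + (suc n C 1)                 ≡⟨ cong suc (*-identityˡ _) ⟨
  1 + 1 * (suc n C 1)             ≡⟨ cong suc (absorption n 0) ⟩
  1 + suc n * 1                   ≡⟨⟩
  suc (suc n) * 1                 ∎
  where open ≡-Reasoning
absorption (suc n) (suc k) = begin
  (2 + k) * (suc (suc n) C suc (suc k))
    ≡⟨ cong ((2 + k) *_) (nCk+nC[k+1]≡[n+1]C[k+1] (suc n) (suc k)) ⟨
  (2 + k) * (A + B)
    ≡⟨ expand k A B ⟩
  A + (suc k * A + (2 + k) * B)
    ≡⟨ cong (A +_) (cong₂ _+_ (absorption n k) (absorption n (suc k))) ⟩
  A + (suc n * (n C k) + suc n * (n C suc k))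
    ≡⟨ cong (A +_) (*-distribˡ-+ (suc n) (n C k) _) ⟨
  A + suc n * ((n C k) + (n C suc k))
    ≡⟨ cong (λ x → A + suc n * x) (nCk+nC[k+1]≡[n+1]C[k+1] n k) ⟩
  (2 + n) * A ∎
  where
  open ≡-Reasoning
  A = suc n C suc k
  B = suc n C suc (suc k)
  expand : ∀ k a b → (2 + k) * (a + b) ≡ a + ((1 + k) * a + (2 + k) * b)
  expand = solve-∀

nCk>0 : ∀ n k → k ≤ n → 0 < n C k
nCk>0 n zero _ = z<s
nCk>0 (suc n) (suc k) (s≤s k≤n) = subst (0 <_) (nCk+nC[k+1]≡[n+1]C[k+1] n k)
  (<-≤-trans (nCk>0 n k k≤n) (m≤m+n _ _))

-- The hypothesis says 1 / D = 1 / A - 1 / B.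
∣-reciprocal-difference : ∀ {A B D N} → 0 < A → 0 < B → A * (B + D) ≡ D * B → A ∣ N → B ∣ N → D ∣ N
∣-reciprocal-difference {A} {B} {D} {N} A>0 B>0 eq (divides a N≡aA) (divides b N≡bB) =
  divides (a ∸ b) (*-cancelʳ-≡ N ((a ∸ b) * D) (A * B) {{m*n≢0 A B {{>-nonZero A>0}} {{>-nonZero B>0}}}} (sym (begin
    (a ∸ b) * D * (A * B)                     ≡⟨ *-assoc (a ∸ b) D (A * B) ⟩
    (a ∸ b) * (D * (A * B))                   ≡⟨ *-distribʳ-∸ (D * (A * B)) a b ⟩
    a * (D * (A * B)) ∸ b * (D * (A * B))     ≡⟨ cong₂ _∸_ (swap₁ a D A B) (swap₂ b D A B) ⟩
    a * A * (D * B) ∸ b * B * (A * D)         ≡⟨ cong₂ (λ x y → x * (D * B) ∸ y * (A * D)) N≡aA N≡bB ⟨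
    N * (D * B) ∸ N * (A * D)                 ≡⟨ *-distribˡ-∸ N (D * B) (A * D) ⟨
    N * (D * B ∸ A * D)                       ≡⟨ cong (λ x → N * (x ∸ A * D)) eq ⟨
    N * (A * (B + D) ∸ A * D)                 ≡⟨ cong (λ x → N * (x ∸ A * D)) (*-distribˡ-+ A B D) ⟩
    N * (A * B + A * D ∸ A * D)               ≡⟨ cong (N *_) (m+n∸n≡m (A * B) (A * D)) ⟩
    N * (A * B)                               ∎)))
  where
  open ≡-Reasoning
  swap₁ : ∀ a D A B → a * (D * (A * B)) ≡ a * A * (D * B)
  swap₁ = solve-∀
  swap₂ : ∀ b D A B → b * (D * (A * B)) ≡ b * B * (A * D)
  swap₂ = solve-∀

-- The entries of Leibniz's harmonic triangle have denominators (n + 1) C(n, k).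
leibniz-∣ : ∀ {L N} → (∀ i → 0 < i → i ≤ L → i ∣ N) →
  ∀ k n → k ≤ n → n < L → suc n * (n C k) ∣ N
leibniz-∣ {N = N} h zero n _ n<L = subst (_∣ N) (sym (*-identityʳ (suc n))) (h (suc n) z<s n<L)
-- The recursion of the triangle: 1 / ((n+2) C(n+1, k+1)) = 1 / ((n+1) C(n, k)) - 1 / ((n+2) C(n+1,
-- k)).
leibniz-∣ h (suc k) (suc n) (s≤s k≤n) 1+n<L = ∣-reciprocal-difference
  {suc n * (n C k)} {suc (suc n) * (suc n C k)} {suc (suc n) * (suc n C suc k)}
  (*-mono-≤ (z<s {n}) (nCk>0 n k k≤n))
  (*-mono-≤ (z<s {suc n}) (nCk>0 (suc n) k (m≤n⇒m≤1+n k≤n)))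
  identity
  (leibniz-∣ h k n k≤n (<-trans (n<1+n n) 1+n<L))
  (leibniz-∣ h k (suc n) (m≤n⇒m≤1+n k≤n) 1+n<L)
  where
  open ≡-Reasoning
  c = suc n C k
  d = suc n C suc k
  rearrange : ∀ k n d e → (1 + k) * d * ((2 + n) * e) ≡ (2 + n) * d * ((1 + k) * e)
  rearrange = solve-∀
  identity : suc n * (n C k) * (suc (suc n) * c + suc (suc n) * d) ≡ suc (suc n) * d * (suc (suc n) * c)
  identity = begin
    suc n * (n C k) * (suc (suc n) * c + suc (suc n) * d)
      ≡⟨ cong₂ _*_ (sym (absorption n k)) (sym (*-distribˡ-+ (suc (suc n)) c d)) ⟩
    suc k * d * (suc (suc n) * (c + d))
      ≡⟨ cong (λ x → suc k * d * (suc (suc n) * x)) (nCk+nC[k+1]≡[n+1]C[k+1] (suc n) k) ⟩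
    suc k * d * (suc (suc n) * (suc (suc n) C suc k))
      ≡⟨ rearrange k n d (suc (suc n) C suc k) ⟩
    suc (suc n) * d * (suc k * (suc (suc n) C suc k))
      ≡⟨ cong (suc (suc n) * d *_) (absorption (suc n) k) ⟩
    suc (suc n) * d * (suc (suc n) * c) ∎

-- Expanding C(2n+2, n+1) by Pascal's rule twice leaves two terms that are each at least C(2n, n).
2^n≤2nCn : ∀ n → 2 ^ n ≤ (n + n) C n
2^n≤2nCn zero = ≤-refl
2^n≤2nCn (suc n) = begin
  2 * 2 ^ n                                        ≤⟨ *-monoʳ-≤ 2 (2^n≤2nCn n) ⟩
  2 * ((n + n) C n)                                ≡⟨ cong ((n + n) C n +_) (+-identityʳ _) ⟩
  (n + n) C n + (n + n) C n                        ≤⟨ +-mono-≤ (lower n) (m≤m+n _ _) ⟩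
  suc (n + n) C n + ((n + n) C n + (n + n) C suc n) ≡⟨ cong (suc (n + n) C n +_) (nCk+nC[k+1]≡[n+1]C[k+1] (n + n) n) ⟩
  suc (n + n) C n + suc (n + n) C suc n            ≡⟨ nCk+nC[k+1]≡[n+1]C[k+1] (suc (n + n)) n ⟩
  suc (suc (n + n)) C suc n                        ≡⟨ cong (λ m → suc m C suc n) (+-suc n n) ⟨
  (suc n + suc n) C suc n                          ∎
  where
  open ≤-Reasoning
  lower : ∀ k → (n + n) C k ≤ suc (n + n) C k
  lower zero = ≤-refl
  lower (suc k) = subst ((n + n) C suc k ≤_) (nCk+nC[k+1]≡[n+1]C[k+1] (n + n) k) (m≤n+m _ _)

-- With `n = 2 ^ u`, the number (2n+1) C(2n, n) is at least `2 ^ n` and divides a common multiple of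
-- 1, ..., 4n that is at most (4n) ^ π(4n). As 4n is a power of 2, exponents of 2 can be compared.
π-lower-bound : ∀ u → 2 ^ u ≤ (2 + u) * count isPrime (suc (2 ^ (2 + u)))
π-lower-bound u
  with N , N>0 , N≤ , h ← commonMultiple (2 ^ (2 + u)) (m^n>0 2 (2 + u))
  = ^-cancelˡ-≤ (s<s z<s) (begin
      2 ^ n                  ≤⟨ 2^n≤2nCn n ⟩
      (n + n) C n            ≤⟨ m≤n*m _ (suc (n + n)) ⟩
      suc (n + n) * ((n + n) C n) ≤⟨ ∣⇒≤ {{>-nonZero N>0}} (leibniz-∣ h n (n + n) (m≤m+n n n) 2n<2^[2+u]) ⟩
      N                      ≤⟨ N≤ ⟩
      (2 ^ (2 + u)) ^ P      ≡⟨ ^-*-assoc 2 (2 + u) P ⟩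
      2 ^ ((2 + u) * P)      ∎)
  where
  open ≤-Reasoning
  n = 2 ^ u
  P = count isPrime (suc (2 ^ (2 + u)))
  4n : ∀ n → 2 * (2 * n) ≡ n + n + (n + n)
  4n = solve-∀
  2n<2^[2+u] : n + n < 2 ^ (2 + u)
  2n<2^[2+u] = subst (n + n <_) (sym (4n n)) (m<m+n (n + n) (<-≤-trans (m^n>0 2 u) (m≤m+n n n)))

-- The constant is the 4 · 3 · 3 that arises in `π-growth`. The threshold is sharp: 36 · 8 > 2 ^ 8,
-- while 36 · 9 = 324 ≤ 512.
36n≤2^n : ∀ n → 9 ≤ n → 36 * n ≤ 2 ^ n
36n≤2^n n 9≤n = subst (λ m → 36 * m ≤ 2 ^ m) (m∸n+n≡m 9≤n) (go (n ∸ 9))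
  where
  go : ∀ k → 36 * (k + 9) ≤ 2 ^ (k + 9)
  go zero = ≤ᵇ⇒≤ _ _ _
  go (suc k) = begin
    36 * suc (k + 9)              ≡⟨ *-suc 36 (k + 9) ⟩
    36 + 36 * (k + 9)             ≤⟨ +-monoˡ-≤ (36 * (k + 9)) (*-monoʳ-≤ 36 (≤-trans (s≤s z≤n) (m≤n+m 9 k))) ⟩
    36 * (k + 9) + 36 * (k + 9)   ≤⟨ +-mono-≤ (go k) (go k) ⟩
    2 ^ (k + 9) + 2 ^ (k + 9)     ≡⟨ cong (2 ^ (k + 9) +_) (+-identityʳ _) ⟨
    2 ^ suc (k + 9)               ∎
    where open ≤-Reasoning

-- The trivial bound π x ≤ x at `2 ^ K` is played against Chebyshev's bound at `2 ^ (K + s)`: the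
-- factor `2 ^ s` gained outweighs the loss, which is linear in `K + s ≤ 3 * s`. It is applied with
-- `K = s` and `K = s + s`.
π-growth : ∀ K s → 9 ≤ s → K ≤ s + s →
  3 * count isPrime (suc (2 ^ K)) ≤ count isPrime (suc (2 ^ (K + s)))
π-growth K s 9≤s K≤2s = ≤-trans (*-monoʳ-≤ 3 (count-isPrime-≤ (2 ^ K))) (≮⇒≥ λ P<3·2^K →
  <-irrefl refl (begin-strict
    2 ^ K * 2 ^ s           ≡⟨ ^-distribˡ-+-* 2 K s ⟨
    2 ^ (K + s)             ≡⟨ cong (2 ^_) K+s≡2+u ⟩
    2 ^ (2 + u)             ≡⟨ *-assoc 2 2 (2 ^ u) ⟨
    4 * 2 ^ u               ≤⟨ *-monoʳ-≤ 4 (π-lower-bound u) ⟩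
    4 * ((2 + u) * count isPrime (suc (2 ^ (2 + u)))) ≡⟨ cong (λ t → 4 * (t * count isPrime (suc (2 ^ t)))) K+s≡2+u ⟨
    4 * ((K + s) * P)       <⟨ *-monoʳ-< 4 (*-monoʳ-< (K + s) {{>-nonZero (<-≤-trans s>0 (m≤n+m s K))}} P<3·2^K) ⟩
    4 * ((K + s) * (3 * 2 ^ K)) ≤⟨ *-monoʳ-≤ 4 (*-monoˡ-≤ (3 * 2 ^ K) (+-monoˡ-≤ s K≤2s)) ⟩
    4 * ((s + s + s) * (3 * 2 ^ K)) ≡⟨ collect s (2 ^ K) ⟩
    2 ^ K * (36 * s)        ≤⟨ *-monoʳ-≤ (2 ^ K) (36n≤2^n s 9≤s) ⟩
    2 ^ K * 2 ^ s           ∎))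
  where
  open ≤-Reasoning
  P = count isPrime (suc (2 ^ (K + s)))
  u = (K + s) ∸ 2
  s>0 : 0 < s
  s>0 = ≤-trans (s≤s z≤n) 9≤s
  K+s≡2+u : K + s ≡ 2 + u
  K+s≡2+u = sym (m+[n∸m]≡n (≤-trans (≤-trans (s≤s (s≤s z≤n)) 9≤s) (m≤n+m s K)))
  collect : ∀ s x → 4 * ((s + s + s) * (3 * x)) ≡ x * (36 * s)
  collect = solve-∀

-- The numbers 2 ^ 3 ^ k

mersenne : ℕ → ℕ
mersenne n = pred (2 ^ n)

suc-mersenne : ∀ n → suc (mersenne n) ≡ 2 ^ n
suc-mersenne n = suc-pred (2 ^ n) {{m^n≢0 2 n}}

mersenne-+ : ∀ a b → mersenne (a + b) ≡ 2 ^ a * mersenne b + mersenne a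
mersenne-+ a b = suc-injective (begin
  suc (mersenne (a + b))                 ≡⟨ suc-mersenne (a + b) ⟩
  2 ^ (a + b)                            ≡⟨ ^-distribˡ-+-* 2 a b ⟩
  2 ^ a * 2 ^ b                          ≡⟨ cong (2 ^ a *_) (suc-mersenne b) ⟨
  2 ^ a * suc (mersenne b)               ≡⟨ *-suc (2 ^ a) (mersenne b) ⟩
  2 ^ a + 2 ^ a * mersenne b             ≡⟨ cong (_+ 2 ^ a * mersenne b) (suc-mersenne a) ⟨
  suc (mersenne a + 2 ^ a * mersenne b)  ≡⟨ cong suc (+-comm (mersenne a) _) ⟩
  suc (2 ^ a * mersenne b + mersenne a)  ∎)
  where open ≡-Reasoning

mersenne-injective : ∀ {a b} → mersenne a ≡ mersenne b → a ≡ b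
mersenne-injective {a} {b} eq = ≤-antisym (half eq) (half (sym eq))
  where
  half : ∀ {a b} → mersenne a ≡ mersenne b → a ≤ b
  half {a} {b} eq = ^-cancelˡ-≤ (s<s z<s) (≤-reflexive
    (trans (sym (suc-mersenne a)) (trans (cong suc eq) (suc-mersenne b))))

mersenne-∣ : ∀ {d n} → d ∣ n → mersenne d ∣ mersenne n
mersenne-∣ {d} (divides q refl) = go q
  where
  go : ∀ q → mersenne d ∣ mersenne (q * d)
  go zero = mersenne d ∣0
  go (suc q) = subst (mersenne d ∣_) (sym (mersenne-+ d (q * d)))
    (∣m∣n⇒∣m+n (∣n⇒∣m*n (2 ^ d) (go q)) ∣-refl)

-- Modulo 2 ^ d - 1 the number 2 ^ n - 1 is congruent to 2 ^ (n % d) - 1, which is smaller than the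
-- modulus and therefore must vanish.
mersenne-∣⁻ : ∀ {d n} → mersenne d ∣ mersenne n → d ∣ n
mersenne-∣⁻ {zero} {n} 0∣ = subst (0 ∣_) (mersenne-injective (sym (0∣⇒≡0 0∣))) ∣-refl
mersenne-∣⁻ {d@(suc _)} {n} d∣n = m%n≡0⇒n∣m n d (mersenne-injective r≡0)
  where
  r = n % d
  d∣r : mersenne d ∣ mersenne r
  d∣r = ∣m+n∣m⇒∣n
    (subst (mersenne d ∣_) (trans (cong mersenne (m≡m%n+[m/n]*n n d)) (mersenne-+ r (n / d * d))) d∣n)
    (∣n⇒∣m*n (2 ^ r) (mersenne-∣ (n∣m*n (n / d))))
  r≡0 : mersenne r ≡ 0
  r≡0 with mersenne r in eq
  ... | zero = refl
  ... | suc m = contradiction (∣⇒≤ (subst (mersenne d ∣_) eq d∣r))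
    (<⇒≱ (subst (_< mersenne d) eq (pred-mono-< {{m^n≢0 2 r}} (^-monoʳ-< 2 (s<s z<s) (m%n<n n d)))))

prime[3] : Prime 3
prime[3] = toWitness {a? = prime? 3} _

-- Here suc w = 2 ^ n and v = 2 ^ d - 1, so that 7 = 2 ^ 3 - 1 divides v iff 3 divides d.
Tower : ℕ → Set
Tower w = (∀ d → d ∣ suc w → d ≡ 1 ⊎ 2 ∣ d) × (∀ v → v ∣ w → suc v ∣ suc w → v ≡ 1 ⊎ 7 ∣ v)

tower-complete : ∀ k → Tower (mersenne (3 ^ k))
tower-complete k = pow2 , pow3
  where
  n = 3 ^ k
  pow2 : ∀ d → d ∣ suc (mersenne n) → d ≡ 1 ⊎ 2 ∣ d
  pow2 d d∣x with ∣prime^⇒prime^ prime[2] n (subst (d ∣_) (suc-mersenne n) d∣x)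
  ... | zero  , d≡ = inj₁ d≡
  ... | suc j , d≡ = inj₂ (subst (2 ∣_) (sym d≡) (m∣m*n (2 ^ j)))
  pow3 : ∀ v → v ∣ mersenne n → suc v ∣ suc (mersenne n) → v ≡ 1 ⊎ 7 ∣ v
  -- As a divisor of `2 ^ n`, `suc v` is some `2 ^ j`; then `v ∣ w` is divisibility of Mersenne
  -- numbers and yields `j ∣ 3 ^ k`.
  pow3 v v∣w x∣
    with j , 1+v≡ ← ∣prime^⇒prime^ prime[2] n (subst (suc v ∣_) (suc-mersenne n) x∣)
    with refl ← suc-injective (trans 1+v≡ (sym (suc-mersenne j)))
    with ∣prime^⇒prime^ prime[3] k (mersenne-∣⁻ {j} {n} v∣w)
  ... | zero  , refl = inj₁ refl
  ... | suc i , refl = inj₂ (mersenne-∣ (m∣m*n {3} (3 ^ i)))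

-- The first half of `Tower` gives `suc w = 2 ^ n`. For each `d ∣ n` the number 2 ^ d - 1 meets both
-- premises of the second half, whose conclusion translates back to `d ≡ 1` or `3 ∣ d`; so `n` is a
-- power of 3.
tower-sound : ∀ {w} → 0 < w → Tower w → ∃ λ k → suc w ≡ 2 ^ (3 ^ k)
tower-sound {w} w>0 (pow2 , pow3) with prime^-criterion prime[2] z<s pow2
... | zero , 1+w≡ = contradiction (sym (suc-injective 1+w≡)) (<⇒≢ w>0)
... | n@(suc _) , 1+w≡ with w≡ ← suc-injective (trans 1+w≡ (sym (suc-mersenne n))) =
  let k , n≡ = prime^-criterion prime[3] z<s divisor in k , trans 1+w≡ (cong (2 ^_) n≡)
  where
  divisor : ∀ d → d ∣ n → d ≡ 1 ⊎ 3 ∣ d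
  divisor d d∣n@(divides q n≡) with pow3 (mersenne d)
    (subst (mersenne d ∣_) (sym w≡) (mersenne-∣ d∣n))
    (subst₂ _∣_ (sym (suc-mersenne d)) (sym 1+w≡)
      (^-monoʳ-∣ 2 (∣⇒≤ d∣n)))
  ... | inj₁ d≡1 = inj₁ (mersenne-injective {d} {1} d≡1)
  ... | inj₂ 7∣  = inj₂ (mersenne-∣⁻ {3} {d} 7∣)

-- Formulas with their interpretation in Z_m

mapReflects : ∀ {A B : Set} {b} → (A → B) → (B → A) → Reflects A b → Reflects B b
mapReflects f g (ofʸ a)  = ofʸ (f a)
mapReflects f g (ofⁿ ¬a) = ofⁿ (¬a ∘ g)

module _ {A : Set} {p : A → Bool} where

  -- Stated for `tabulate f` because `allFin m` unfolds to `tabulate id`, and the induction changes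
  -- the function.
  all-reflects : ∀ {n} {P : Fin n → Set} (f : Fin n → A) →
    (∀ i → Reflects (P i) (p (f i))) → Reflects (∀ i → P i) (all p (tabulate f))
  all-reflects {zero}  f r = ofʸ λ ()
  all-reflects {suc n} f r = mapReflects
    (λ { (h , t) zero → h ; (h , t) (suc i) → t i }) (λ h → h zero , h ∘ suc)
    (r zero ×-reflects all-reflects (f ∘ suc) (r ∘ suc))

  any-reflects : ∀ {n} {P : Fin n → Set} (f : Fin n → A) →
    (∀ i → Reflects (P i) (p (f i))) → Reflects (∃ P) (any p (tabulate f))
  any-reflects {zero}  f r = ofⁿ λ ()
  any-reflects {suc n} f r = mapReflects
    (λ { (inj₁ h) → zero , h ; (inj₂ (i , h)) → suc i , h })
    (λ { (zero , h) → inj₁ h ; (suc i , h) → inj₂ (i , h) })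
    (r zero ⊎-reflects any-reflects (f ∘ suc) (r ∘ suc))

weaken : ∀ {n} → Term n → Term (suc n)
weaken (var i) = var (suc i)
weaken zer     = zer
weaken (s ⊕ t) = weaken s ⊕ weaken t
weaken (s ⊛ t) = weaken s ⊛ weaken t

-- The vocabulary has no symbol for 1, so the order is used: 1 is the nonzero element with only 0
-- below it.
isOne : ∀ {n} → Term n → Formula n
isOne t = (¬' (t ≐ zer)) ∧' (∀' ((var zero ≺ weaken t) ⇒' (var zero ≐ zer)))

-- d e < m, since all steps from d j to d (j + 1) with j < e avoid wrapping around.
noOverflow : ∀ {n} → Term n → Term n → Formula n
noOverflow d e = ∀' ((var zero ≺ weaken e) ⇒'
  ((weaken d ⊛ var zero) ≺ ((weaken d ⊛ var zero) ⊕ weaken d)))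

-- The overflow clause is essential: in a field `Z_p` the equation alone is solvable for every
-- nonzero `d`.
divides' : ∀ {n} → Term n → Term n → Formula n
divides' d x = ∃' (noOverflow (weaken d) (var zero) ∧' ((weaken d ⊛ var zero) ≐ weaken x))

twice seventimes : ∀ {n} → Term n → Term n
twice t = t ⊕ t
seventimes t = t ⊕ (twice t ⊕ (twice t ⊕ twice t))

-- The first two conjuncts express `Tower w`, with `o` standing for 1 and `x = w ⊕ o`; the last says
-- that the integer x² is at least m. That `x` itself has not wrapped to 0 follows from the first
-- conjunct, since 3 divides 0.
towerOverflow : Formula 2
towerOverflow =
  (∀' (divides' y (w ⊕ o) ⇒' ((y ≐ o) ∨' divides' (twice o) y)))
  ∧' ((∀' ((divides' y w ∧' divides' (y ⊕ o) (w ⊕ o)) ⇒' ((y ≐ o) ∨' divides' (seventimes o) y)))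
  ∧' (¬' noOverflow (var zero ⊕ var (suc zero)) (var zero ⊕ var (suc zero))))
  where
  y w o : Term 3
  y = var zero
  w = var (suc zero)
  o = var (suc (suc zero))

ψ : Sentence
ψ = ∃' (isOne (var zero) ∧' (∃' towerOverflow))

module _ (k : ℕ) where

  private
    m = suc k
    Env : ℕ → Set
    Env n = Fin n → Fin m

  ⟦_⟧ : ∀ {n} → Formula n → Env n → Set
  ⟦ s ≐ t ⟧ ρ  = evalT m ρ s ≡ evalT m ρ t
  ⟦ s ≺ t ⟧ ρ  = toℕ (evalT m ρ s) < toℕ (evalT m ρ t)
  ⟦ ¬' φ ⟧ ρ   = ¬ ⟦ φ ⟧ ρ
  ⟦ φ ∧' χ ⟧ ρ = ⟦ φ ⟧ ρ × ⟦ χ ⟧ ρ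
  ⟦ φ ∨' χ ⟧ ρ = ⟦ φ ⟧ ρ ⊎ ⟦ χ ⟧ ρ
  ⟦ φ ⇒' χ ⟧ ρ = ⟦ φ ⟧ ρ → ⟦ χ ⟧ ρ
  ⟦ ∀' φ ⟧ ρ   = ∀ a → ⟦ φ ⟧ (extend m ρ a)
  ⟦ ∃' φ ⟧ ρ   = ∃ λ a → ⟦ φ ⟧ (extend m ρ a)

  evalF-reflects : ∀ {n} (φ : Formula n) (ρ : Env n) → Reflects (⟦ φ ⟧ ρ) (evalF m ρ φ)
  evalF-reflects (s ≐ t) ρ with evalT m ρ s Fin.≟ evalT m ρ t
  ... | yes eq = ofʸ eq
  ... | no neq = ofⁿ neq
  evalF-reflects (s ≺ t) ρ  = <ᵇ-reflects-< _ _
  evalF-reflects (¬' φ) ρ   = ¬-reflects (evalF-reflects φ ρ)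
  evalF-reflects (φ ∧' χ) ρ = evalF-reflects φ ρ ×-reflects evalF-reflects χ ρ
  evalF-reflects (φ ∨' χ) ρ = evalF-reflects φ ρ ⊎-reflects evalF-reflects χ ρ
  evalF-reflects (φ ⇒' χ) ρ = evalF-reflects φ ρ →-reflects evalF-reflects χ ρ
  evalF-reflects (∀' φ) ρ   = all-reflects id λ a → evalF-reflects φ (extend m ρ a)
  evalF-reflects (∃' φ) ρ   = any-reflects id λ a → evalF-reflects φ (extend m ρ a)

  val : ∀ {n} → Env n → Term n → ℕ
  val ρ t = toℕ (evalT m ρ t)

  evalT-weaken : ∀ {n} (ρ : Env n) a t → evalT m (extend m ρ a) (weaken t) ≡ evalT m ρ t
  evalT-weaken ρ a (var i) = refl
  evalT-weaken ρ a zer     = refl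
  evalT-weaken ρ a (s ⊕ t) = cong₂ (addZ m) (evalT-weaken ρ a s) (evalT-weaken ρ a t)
  evalT-weaken ρ a (s ⊛ t) = cong₂ (mulZ m) (evalT-weaken ρ a s) (evalT-weaken ρ a t)

  toℕ-mod : ∀ x → toℕ (x mod m) ≡ x % m
  toℕ-mod x = toℕ-fromℕ< (m%n<n x m)

  toℕ-addZ : ∀ {a b} → toℕ a + toℕ b < m → toℕ (addZ m a b) ≡ toℕ a + toℕ b
  toℕ-addZ {a} {b} lt = trans (toℕ-mod (toℕ a + toℕ b)) (m<n⇒m%n≡m lt)

  toℕ-mulZ : ∀ {a b} → toℕ a * toℕ b < m → toℕ (mulZ m a b) ≡ toℕ a * toℕ b
  toℕ-mulZ {a} {b} lt = trans (toℕ-mod (toℕ a * toℕ b)) (m<n⇒m%n≡m lt)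

  -- A wrapped sum is a + b - m with b < m. Hence a strict increase certifies that no wrapping took
  -- place.
  addZ-wraps : ∀ {a b} → m ≤ toℕ a + toℕ b → toℕ (addZ m a b) ≤ toℕ a
  addZ-wraps {a} {b} m≤a+b = begin
    toℕ (addZ m a b)           ≡⟨ toℕ-mod (toℕ a + toℕ b) ⟩
    (toℕ a + toℕ b) % m        ≡⟨ m≤n⇒[n∸m]%m≡n%m m≤a+b ⟨
    (toℕ a + toℕ b ∸ m) % m    ≤⟨ m%n≤m _ m ⟩
    toℕ a + toℕ b ∸ m          ≤⟨ m≤n+o⇒m∸n≤o (toℕ a + toℕ b) m
                                    (subst (toℕ a + toℕ b ≤_) (+-comm (toℕ a) m) (+-monoʳ-≤ (toℕ a) (<⇒≤ (toℕ<n b)))) ⟩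
    toℕ a                      ∎
    where open ≤-Reasoning

  noOverflow-sound : ∀ {n} (ρ : Env n) d e → ⟦ noOverflow d e ⟧ ρ → val ρ d * val ρ e < m
  noOverflow-sound ρ d e h = go (val ρ e) ≤-refl
    where
    D = evalT m ρ d
    h′ : ∀ j → toℕ j < val ρ e → toℕ (mulZ m D j) < toℕ (addZ m (mulZ m D j) D)
    h′ j with hj ← h j rewrite evalT-weaken ρ j d | evalT-weaken ρ j e = hj
    -- By induction `D * i` is below `m` and is its own residue; if `D * suc i` reached `m`, adding
    -- `D` would wrap and contradict the strict increase.
    go : ∀ i → i ≤ val ρ e → toℕ D * i < m
    go zero _ = subst (_< m) (sym (*-zeroʳ (toℕ D))) z<s
    go (suc i) i<e = ≰⇒> λ m≤ → <⇒≱ (h′ j j<e) (addZ-wraps {mulZ m D j} {D} (subst (m ≤_) D[1+i]≡ m≤))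
      where
      i<m : i < m
      i<m = <-trans i<e (toℕ<n (evalT m ρ e))
      j = fromℕ< i<m
      j≡i : toℕ j ≡ i
      j≡i = toℕ-fromℕ< i<m
      j<e : toℕ j < val ρ e
      j<e = subst (_< val ρ e) (sym j≡i) i<e
      Dj≡ : toℕ (mulZ m D j) ≡ toℕ D * i
      Dj≡ = trans (toℕ-mulZ {D} {j} (subst (λ x → toℕ D * x < m) (sym j≡i) (go i (<⇒≤ i<e))))
                  (cong (toℕ D *_) j≡i)
      D[1+i]≡ : toℕ D * suc i ≡ toℕ (mulZ m D j) + toℕ D
      D[1+i]≡ = trans (*-suc (toℕ D) i) (trans (+-comm (toℕ D) _) (cong (_+ toℕ D) (sym Dj≡)))

  -- Every multiple involved stays below `m`, so residues agree with integers, and a positive `d`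
  -- makes each step a strict increase.
  noOverflow-complete : ∀ {n} (ρ : Env n) d e → 0 < val ρ d → val ρ d * val ρ e < m → ⟦ noOverflow d e ⟧ ρ
  noOverflow-complete ρ d e D>0 De<m j rewrite evalT-weaken ρ j d | evalT-weaken ρ j e = λ j<e →
    let
      D = evalT m ρ d
      Dj+D<m : toℕ D * toℕ j + toℕ D < m
      Dj+D<m = ≤-<-trans (subst (_≤ toℕ D * val ρ e) (trans (*-suc (toℕ D) (toℕ j)) (+-comm (toℕ D) _))
                 (*-monoʳ-≤ (toℕ D) j<e)) De<m
      Dj≡ = toℕ-mulZ {D} {j} (≤-<-trans (m≤m+n _ (toℕ D)) Dj+D<m)
    in subst₂ _<_ (sym Dj≡)
         (sym (trans (toℕ-addZ {mulZ m D j} {D} (subst (λ x → x + toℕ D < m) (sym Dj≡) Dj+D<m)) (cong (_+ toℕ D) Dj≡)))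
         (m<m+n (toℕ D * toℕ j) D>0)

  divides'-sound : ∀ {n} (ρ : Env n) d x → ⟦ divides' d x ⟧ ρ → val ρ d ∣ val ρ x
  divides'-sound ρ d x (e , no-ovf , eq)
    with De<m ← noOverflow-sound (extend m ρ e) (weaken d) (var zero) no-ovf
    rewrite evalT-weaken ρ e d | evalT-weaken ρ e x
    = divides (toℕ e) (trans (sym (cong toℕ eq)) (trans (toℕ-mulZ {evalT m ρ d} {e} De<m) (*-comm (val ρ d) (toℕ e))))

  divides'-complete : ∀ {n} (ρ : Env n) d x → 0 < val ρ d → val ρ d ∣ val ρ x → ⟦ divides' d x ⟧ ρ
  divides'-complete ρ d x D>0 (divides q x≡) =
    e , noOverflow-complete (extend m ρ e) (weaken d) (var zero)
          (subst (0 <_) (cong toℕ (sym (evalT-weaken ρ e d))) D>0)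
          (subst (_< m) (cong (λ a → toℕ a * toℕ e) (sym (evalT-weaken ρ e d))) De<m)
      , toℕ-injective (begin
          toℕ (mulZ m (evalT m (extend m ρ e) (weaken d)) e) ≡⟨ cong (λ a → toℕ (mulZ m a e)) (evalT-weaken ρ e d) ⟩
          toℕ (mulZ m (evalT m ρ d) e)                       ≡⟨ toℕ-mulZ {evalT m ρ d} {e} De<m ⟩
          val ρ d * toℕ e                                    ≡⟨ De≡ ⟩
          val ρ x                                            ≡⟨ cong toℕ (evalT-weaken ρ e x) ⟨
          toℕ (evalT m (extend m ρ e) (weaken x))            ∎)
    where
    open ≡-Reasoning
    -- The quotient has to be a residue itself: as `d` is positive, it is at most the value of `x`.
    q<m : q < m
    q<m = ≤-<-trans (subst (q ≤_) (sym x≡) (m≤m*n q (val ρ d) {{>-nonZero D>0}})) (toℕ<n (evalT m ρ x))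
    e = fromℕ< q<m
    De≡ : val ρ d * toℕ e ≡ val ρ x
    De≡ = trans (cong (val ρ d *_) (toℕ-fromℕ< q<m)) (trans (*-comm (val ρ d) q) (sym x≡))
    De<m : val ρ d * toℕ e < m
    De<m = subst (_< m) (sym De≡) (toℕ<n (evalT m ρ x))

  -- Correctness of `ψ` in rings with at least 8 elements

  module _ (8≤m : 8 ≤ m) where

    -- 7 is the largest constant that `ψ` builds from 1, so all its constants keep their integer
    -- values.
    small : ∀ {i} → i ≤ 7 → i < m
    small i≤7 = ≤-trans (s≤s i≤7) 8≤m

    isOne-sound : ∀ {n} (ρ : Env n) t → ⟦ isOne t ⟧ ρ → val ρ t ≡ 1
    isOne-sound ρ t (t≢0 , least) with val ρ t in t≡
    ... | 0 = contradiction (toℕ-injective (trans t≡ (sym (toℕ-mod 0)))) t≢0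
    ... | 1 = refl
    ... | suc (suc _) = contradiction
      (trans (sym 1≡) (trans (cong toℕ (least one (subst₂ _<_ (sym 1≡) (sym wt≡) (s≤s (s≤s z≤n))))) (toℕ-mod 0))) λ ()
      where
      one = fromℕ< (small (s≤s z≤n))
      1≡ : toℕ one ≡ 1
      1≡ = toℕ-fromℕ< (small (s≤s z≤n))
      wt≡ = trans (cong toℕ (evalT-weaken ρ one t)) t≡

    isOne-complete : ∀ {n} (ρ : Env n) t → val ρ t ≡ 1 → ⟦ isOne t ⟧ ρ
    isOne-complete ρ t t≡1 =
      (λ t≡0 → contradiction (trans (sym t≡1) (trans (cong toℕ t≡0) (toℕ-mod 0))) λ ()) ,
      λ a a<t → toℕ-injective (trans (n<1⇒n≡0 (subst (toℕ a <_) (trans (cong toℕ (evalT-weaken ρ a t)) t≡1) a<t)) (sym (toℕ-mod 0)))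

    module _ {n} (ρ : Env n) (o : Term n) (o≡1 : val ρ o ≡ 1) where

      val-⊕ : ∀ s t {i j} → val ρ s ≡ i → val ρ t ≡ j → i + j < m → val ρ (s ⊕ t) ≡ i + j
      val-⊕ s t s≡ t≡ lt = trans (toℕ-addZ {evalT m ρ s} {evalT m ρ t} (subst (_< m) (sym (cong₂ _+_ s≡ t≡)) lt)) (cong₂ _+_ s≡ t≡)

      val-twice : val ρ (twice o) ≡ 2
      val-twice = val-⊕ o o o≡1 o≡1 (small (s≤s (s≤s z≤n)))

      val-seventimes : val ρ (seventimes o) ≡ 7
      val-seventimes = val-⊕ o (twice o ⊕ (twice o ⊕ twice o)) o≡1
        (val-⊕ (twice o) (twice o ⊕ twice o) val-twice
          (val-⊕ (twice o) (twice o) val-twice val-twice (small (m≤m+n 4 3))) (small (m≤m+n 6 1)))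
        (small ≤-refl)

      val-suc : ∀ t → (suc (val ρ t) < m × val ρ (t ⊕ o) ≡ suc (val ρ t)) ⊎ val ρ (t ⊕ o) ≡ 0
      val-suc t with suc (val ρ t) <? m
      ... | yes lt = inj₁ (lt , trans (val-⊕ t o refl o≡1 (subst (_< m) (+-comm 1 _) lt)) (+-comm _ 1))
      ... | no ¬lt = inj₂ (trans (toℕ-mod (val ρ t + val ρ o)) (trans (cong (_% m) sum≡m) (n%n≡0 m)))
        where
        sum≡m : val ρ t + val ρ o ≡ m
        sum≡m = trans (cong (val ρ t +_) o≡1) (trans (+-comm _ 1) (≤-antisym (toℕ<n (evalT m ρ t)) (≮⇒≥ ¬lt)))

    ψ-sound : ⟦ ψ ⟧ (noVars m) → ∃ λ w → Tower w × suc w < m × m ≤ suc w * suc w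
    ψ-sound (o , one , w , pow2 , pow3 , ovf) = body (val-suc ρ (var (suc zero)) o≡1 (var zero))
      where
      ρ : Env 2
      ρ = extend m (extend m (noVars m) o) w
      o≡1 : toℕ o ≡ 1
      o≡1 = isOne-sound (extend m (noVars m) o) (var zero) one
      x : Term 2
      x = var zero ⊕ var (suc zero)

      divisor : ∀ d → 0 < d → d < m → d ∣ val ρ x → d ≡ 1 ⊎ 2 ∣ d
      divisor d d>0 d<m d∣x = Sum.map
        (λ eq → trans (sym a≡d) (trans (cong toℕ eq) o≡1))
        (λ t → subst₂ _∣_ (val-twice ρ′ (var (suc (suc zero))) o≡1) a≡d
                 (divides'-sound ρ′ (twice (var (suc (suc zero)))) (var zero) t))
        (pow2 a (divides'-complete ρ′ (var zero) (weaken x) (subst (0 <_) (sym a≡d) d>0)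
          (subst (_∣ val ρ x) (sym a≡d) d∣x)))
        where
        a = fromℕ< d<m
        a≡d : toℕ a ≡ d
        a≡d = toℕ-fromℕ< d<m
        ρ′ = extend m ρ a

      body : (suc (toℕ w) < m × val ρ x ≡ suc (toℕ w)) ⊎ val ρ x ≡ 0 →
             ∃ λ w → Tower w × suc w < m × m ≤ suc w * suc w
      -- If `w + 1` wraps to 0, every number divides it, but 3 is neither 1 nor even.
      body (inj₂ x≡0) = contradiction (divisor 3 z<s (small (m≤m+n 3 4)) (subst (3 ∣_) (sym x≡0) (3 ∣0)))
        λ { (inj₂ 2∣3) → >⇒∤ (s≤s (s≤s z≤n)) (∣m+n∣m⇒∣n {m = 2} {n = 1} 2∣3 ∣-refl) }
      body (inj₁ (1+w<m , x≡)) = toℕ w , (pow2′ , pow3′) , 1+w<m , m≤x²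
        where
        m≤x² : m ≤ suc (toℕ w) * suc (toℕ w)
        m≤x² = ≮⇒≥ λ x²<m → ovf (noOverflow-complete ρ x x (subst (0 <_) (sym x≡) z<s)
          (subst (_< m) (sym (cong₂ _*_ x≡ x≡)) x²<m))
        pow2′ : ∀ d → d ∣ suc (toℕ w) → d ≡ 1 ⊎ 2 ∣ d
        pow2′ d d∣x = divisor d (n≢0⇒n>0 λ { refl → contradiction (0∣⇒≡0 d∣x) λ () })
          (≤-<-trans (∣⇒≤ d∣x) 1+w<m) (subst (d ∣_) (sym x≡) d∣x)
        pow3′ : ∀ v → v ∣ toℕ w → suc v ∣ suc (toℕ w) → v ≡ 1 ⊎ 7 ∣ v
        -- `v = 0` would force `w = 0`, so that x = 1, against m ≤ x².
        pow3′ zero 0∣w _ = contradiction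
          (subst (λ w → m ≤ suc w * suc w) (0∣⇒≡0 0∣w) m≤x²) (<⇒≱ (small (s≤s z≤n)))
        pow3′ v@(suc _) v∣w 1+v∣x = Sum.map
          (λ eq → trans (sym a≡v) (trans (cong toℕ eq) o≡1))
          (λ t → subst₂ _∣_ (val-seventimes ρ′ o′ o≡1) a≡v (divides'-sound ρ′ (seventimes o′) a′ t))
          (pow3 a
            ( divides'-complete ρ′ a′ (var (suc zero)) (subst (0 <_) (sym a≡v) z<s)
                (subst (_∣ toℕ w) (sym a≡v) v∣w)
            , divides'-complete ρ′ (a′ ⊕ o′) (weaken x) (subst (0 <_) (sym a+1≡) z<s)
                (subst₂ _∣_ (sym a+1≡) (sym x≡) 1+v∣x)))
          where
          1+v<m : suc v < m
          1+v<m = ≤-<-trans (∣⇒≤ 1+v∣x) 1+w<m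
          a = fromℕ< (<-trans (n<1+n v) 1+v<m)
          a≡v : toℕ a ≡ v
          a≡v = toℕ-fromℕ< (<-trans (n<1+n v) 1+v<m)
          ρ′ = extend m ρ a
          a′ o′ : Term 3
          a′ = var zero
          o′ = var (suc (suc zero))
          a+1≡ : val ρ′ (a′ ⊕ o′) ≡ suc v
          a+1≡ = trans (val-⊕ ρ′ o′ o≡1 a′ o′ a≡v o≡1 (subst (_< m) (+-comm 1 v) 1+v<m)) (+-comm v 1)

    ψ-complete : ∀ {w} → Tower w → suc w < m → m ≤ suc w * suc w → ⟦ ψ ⟧ (noVars m)
    ψ-complete {w} (pow2 , pow3) 1+w<m m≤x² =
      one , isOne-complete (extend m (noVars m) one) (var zero) one≡1 , w′ , clause₂ , clause₃ , ovf
      where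
      one = fromℕ< (small (s≤s z≤n))
      one≡1 : toℕ one ≡ 1
      one≡1 = toℕ-fromℕ< (small (s≤s z≤n))
      w<m = <-trans (n<1+n w) 1+w<m
      w′ = fromℕ< w<m
      w′≡w : toℕ w′ ≡ w
      w′≡w = toℕ-fromℕ< w<m
      ρ : Env 2
      ρ = extend m (extend m (noVars m) one) w′
      x : Term 2
      x = var zero ⊕ var (suc zero)
      a′ o′ : Term 3
      a′ = var zero
      o′ = var (suc (suc zero))
      x≡ : val ρ x ≡ suc w
      x≡ = trans (val-⊕ ρ (var (suc zero)) one≡1 (var zero) (var (suc zero)) w′≡w one≡1
             (subst (_< m) (+-comm 1 w) 1+w<m)) (+-comm w 1)

      clause₂ : ∀ a → ⟦ divides' a′ (weaken x) ⟧ (extend m ρ a) →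
                a ≡ one ⊎ ⟦ divides' (twice o′) a′ ⟧ (extend m ρ a)
      clause₂ a a∣x = Sum.map
        (λ a≡1 → toℕ-injective (trans a≡1 (sym one≡1)))
        (λ 2∣a → divides'-complete ρ′ (twice o′) a′ (subst (0 <_) (sym 2≡) z<s) (subst (_∣ toℕ a) (sym 2≡) 2∣a))
        (pow2 (toℕ a) (subst (toℕ a ∣_) x≡ (divides'-sound ρ′ a′ (weaken x) a∣x)))
        where
        ρ′ = extend m ρ a
        2≡ = val-twice ρ′ o′ one≡1

      clause₃ : ∀ a → ⟦ divides' a′ (var (suc zero)) ∧' divides' (a′ ⊕ o′) (weaken x) ⟧ (extend m ρ a) →
                a ≡ one ⊎ ⟦ divides' (seventimes o′) a′ ⟧ (extend m ρ a)
      clause₃ a (a∣w , a+1∣x) = go (val-suc ρ′ o′ one≡1 a′)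
        where
        ρ′ = extend m ρ a
        7≡ = val-seventimes ρ′ o′ one≡1
        a+1∣1+w : val ρ′ (a′ ⊕ o′) ∣ suc w
        a+1∣1+w = subst (val ρ′ (a′ ⊕ o′) ∣_) x≡ (divides'-sound ρ′ (a′ ⊕ o′) (weaken x) a+1∣x)
        go : (suc (toℕ a) < m × val ρ′ (a′ ⊕ o′) ≡ suc (toℕ a)) ⊎ val ρ′ (a′ ⊕ o′) ≡ 0 →
             a ≡ one ⊎ ⟦ divides' (seventimes o′) a′ ⟧ ρ′
        -- Here `a = m - 1`, and the wrapped sum 0 cannot divide the positive `suc w`.
        go (inj₂ a+1≡0) = contradiction (0∣⇒≡0 (subst (_∣ suc w) a+1≡0 a+1∣1+w)) λ ()
        go (inj₁ (_ , a+1≡)) = Sum.map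
          (λ a≡1 → toℕ-injective (trans a≡1 (sym one≡1)))
          (λ 7∣a → divides'-complete ρ′ (seventimes o′) a′ (subst (0 <_) (sym 7≡) z<s) (subst (_∣ toℕ a) (sym 7≡) 7∣a))
          (pow3 (toℕ a) (subst (toℕ a ∣_) w′≡w (divides'-sound ρ′ a′ (var (suc zero)) a∣w))
            (subst (_∣ suc w) a+1≡ a+1∣1+w))

      ovf : ¬ ⟦ noOverflow x x ⟧ ρ
      ovf no-ovf = <⇒≱ (subst (_< m) (cong₂ _*_ x≡ x≡) (noOverflow-sound ρ x x no-ovf)) m≤x²

-- The prime spectrum of ψ

models-sound : ∀ k σ → modelsℕ (suc k) σ ≡ true → ⟦_⟧ k σ (noVars (suc k))
models-sound k σ eq = invert (subst (Reflects _) eq (evalF-reflects k σ (noVars (suc k))))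

models-complete : ∀ k σ → ⟦_⟧ k σ (noVars (suc k)) → modelsℕ (suc k) σ ≡ true
models-complete k σ h = det (evalF-reflects k σ (noVars (suc k))) (ofʸ h)

Sp⇒isPrime : ∀ σ q → Sp σ q ≡ true → isPrime q ≡ true
Sp⇒isPrime σ q = ∧-conicalˡ (isPrime q) (modelsℕ q σ)

Sp⇒models : ∀ σ q → Sp σ q ≡ true → modelsℕ q σ ≡ true
Sp⇒models σ q = ∧-conicalʳ (isPrime q) (modelsℕ q σ)

Sp-intro : ∀ σ q → isPrime q ≡ true → modelsℕ q σ ≡ true → Sp σ q ≡ true
Sp-intro σ q = cong₂ _∧_

Sp-sound : ∀ q → 8 ≤ q → Sp ψ q ≡ true → ∃ λ k → 2 ^ (3 ^ k) < q × q ≤ 2 ^ (3 ^ k) * 2 ^ (3 ^ k)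
Sp-sound (suc i) 8≤q sp = go (ψ-sound i 8≤q (models-sound i ψ (Sp⇒models ψ (suc i) sp)))
  where
  go : (∃ λ w → Tower w × suc w < suc i × suc i ≤ suc w * suc w) →
       ∃ λ k → 2 ^ (3 ^ k) < suc i × suc i ≤ 2 ^ (3 ^ k) * 2 ^ (3 ^ k)
  go (w , tower , x<q , q≤x²)
    with k , x≡ ← tower-sound (n≢0⇒n>0 λ { refl → <⇒≱ (≤-trans (s≤s (s≤s z≤n)) 8≤q) q≤x² }) tower
    = k , subst (_< suc i) x≡ x<q , subst (λ x → suc i ≤ x * x) x≡ q≤x²

Sp-complete : ∀ q k → 8 ≤ q → isPrime q ≡ true →
  2 ^ (3 ^ k) < q → q ≤ 2 ^ (3 ^ k) * 2 ^ (3 ^ k) → Sp ψ q ≡ true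
Sp-complete (suc i) k 8≤q pq x<q q≤x² = Sp-intro ψ (suc i) pq (models-complete i ψ
  (ψ-complete i 8≤q (tower-complete k)
    (subst (_< suc i) (sym x≡) x<q) (subst (λ x → suc i ≤ x * x) (sym x≡) q≤x²)))
  where x≡ = suc-mersenne (3 ^ k)

-- Oscillation of the ratio

n<m^n : ∀ {m} → 1 < m → ∀ n → n < m ^ n
n<m^n 1<m zero = z<s
n<m^n {m} 1<m (suc n) = ≤-<-trans (n<m^n 1<m n) (^-monoʳ-< m 1<m (n<1+n n))


π-positive : ∀ t → 2 ≤ t → 0 < count isPrime (suc (2 ^ t))
π-positive (suc zero) (s≤s ())
π-positive (suc (suc u)) _ = n≢0⇒n>0 λ P≡0 →
  <⇒≱ (m^n>0 2 u) (≤-trans (π-lower-bound u) (≤-reflexive (trans (cong ((2 + u) *_) P≡0) (*-zeroʳ (2 + u)))))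

-- Positivity excludes the default branch of `ratio`; `k` appears because `mkℚᵘ` stores the
-- denominator minus one.
ratio≡ : ∀ S n → 0 < count isPrime (suc n) →
  ∃ λ k → count isPrime (suc n) ≡ suc k × ratio S n ≡ mkℚᵘ (ℤ.+ count S (suc n)) k
ratio≡ S n π>0 with π n in eq
... | zero  = contradiction (trans (sym (πS≡count isPrime n)) eq) (>⇒≢ π>0)
... | suc k = k , trans (sym (πS≡count isPrime n)) eq , cong (λ c → mkℚᵘ (ℤ.+ c) k) (πS≡count S n)

mkℚᵘ-≤ : ∀ {a b c d} → a * suc d ≤ c * suc b → mkℚᵘ (ℤ.+ a) b ℚ.≤ mkℚᵘ (ℤ.+ c) d
mkℚᵘ-≤ {a} {b} {c} {d} le = *≤* (subst₂ ℤ._≤_ (ℤ.pos-* a (suc d)) (ℤ.pos-* c (suc b)) (ℤ.+≤+ le))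

p≤∣p∣ : ∀ p → p ℚ.≤ ℚ.∣ p ∣
p≤∣p∣ (mkℚᵘ (ℤ.+ n) d)       = ℚ.≤-refl
p≤∣p∣ (mkℚᵘ ℤ.-[1+ n ] d) = *≤* ℤ.-≤+

⅓ ⅔ : ℚᵘ
⅓ = mkℚᵘ (ℤ.+ 1) 2
⅔ = mkℚᵘ (ℤ.+ 2) 2

⅔≤p∧q≤⅓⇒⅓≤∣p-q∣ : ∀ p q → ⅔ ℚ.≤ p → q ℚ.≤ ⅓ → ⅓ ℚ.≤ ℚ.∣ p ℚ.- q ∣
-- `⅔ - ⅓` computes to the unreduced 3/9, so the first comparison is 1 · 9 ≤ 3 · 3.
⅔≤p∧q≤⅓⇒⅓≤∣p-q∣ p q ⅔≤p q≤⅓ = ℚ.≤-trans (*≤* (ℤ.+≤+ ≤-refl))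
  (ℚ.≤-trans (ℚ.+-mono-≤ ⅔≤p (ℚ.neg-mono-≤ q≤⅓)) (p≤∣p∣ (p ℚ.- q)))

module _ {S : ℕ → Bool}
  (S⇒isPrime : ∀ q → S q ≡ true → isPrime q ≡ true)
  (S-sound : ∀ q → 8 ≤ q → S q ≡ true → ∃ λ k → 2 ^ (3 ^ k) < q × q ≤ 2 ^ (3 ^ k) * 2 ^ (3 ^ k))
  (S-complete : ∀ q k → 8 ≤ q → isPrime q ≡ true →
    2 ^ (3 ^ k) < q → q ≤ 2 ^ (3 ^ k) * 2 ^ (3 ^ k) → S q ≡ true)
  where

  module _ {k s} (s≡3^k : s ≡ 3 ^ k) (9≤s : 9 ≤ s) where

    private
      -- With x = `2 ^ s`, these are π at x, x² and x³, followed by the counts of `S` at x² and x³.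
      A = count isPrime (suc (2 ^ s))
      B = count isPrime (suc (2 ^ (s + s)))
      C = count isPrime (suc (2 ^ (s + s + s)))
      S-B = count S (suc (2 ^ (s + s)))
      S-C = count S (suc (2 ^ (s + s + s)))

      8≤2^ : ∀ {t} → s ≤ t → 8 ≤ 2 ^ t
      8≤2^ s≤t = ^-monoʳ-≤ 2 {3} (≤-trans (≤-trans (m≤m+n 3 6) 9≤s) s≤t)

    -- All primes in (x, x²] lie in `S`, so `B ≤ A + S-B`; tripling, inserting `3 * A ≤ B` and
    -- cancelling one `B` gives the claim.
    count-block : 2 * B ≤ 3 * S-B
    count-block = +-cancelˡ-≤ B (2 * B) (3 * S-B) (begin
      3 * B              ≤⟨ *-monoʳ-≤ 3 (count-split (suc (2 ^ s)) (suc (2 ^ (s + s)))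
                              (s≤s (^-monoʳ-≤ 2 (m≤m+n s s))) (λ _ p → p) inside) ⟩
      3 * (A + S-B)      ≡⟨ *-distribˡ-+ 3 A S-B ⟩
      3 * A + 3 * S-B    ≤⟨ +-monoˡ-≤ (3 * S-B) (π-growth s s 9≤s (m≤m+n s s)) ⟩
      B + 3 * S-B        ∎)
      where
      open ≤-Reasoning
      inside : ∀ q → 2 ^ s < q → q < suc (2 ^ (s + s)) → isPrime q ≡ true → S q ≡ true
      inside q a<q q≤b pq = S-complete q k (≤-trans (8≤2^ ≤-refl) (<⇒≤ a<q)) pq
        (subst (λ s → 2 ^ s < q) s≡3^k a<q)
        (subst (λ s → q ≤ 2 ^ s * 2 ^ s) s≡3^k (subst (q ≤_) (^-distribˡ-+-* 2 s s) (s≤s⁻¹ q≤b)))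

    -- Nothing in (x², x³] belongs to `S`, so `S-C ≤ B`, and π triples at least from x² to x³.
    count-gap : 3 * S-C ≤ C
    count-gap = begin
      3 * S-C                                 ≤⟨ *-monoʳ-≤ 3 (count-split (suc (2 ^ (s + s))) (suc (2 ^ (s + s + s)))
                                                   (s≤s (^-monoʳ-≤ 2 (m≤m+n (s + s) s))) S⇒isPrime
                                                   λ q a<q q≤b Sq → contradiction Sq (outside q a<q q≤b)) ⟩
      3 * (B + count (λ _ → false) (suc (2 ^ (s + s + s))))
                                              ≡⟨ cong (λ c → 3 * (B + c)) (count-false (suc (2 ^ (s + s + s)))) ⟩
      3 * (B + 0)                             ≡⟨ cong (3 *_) (+-identityʳ B) ⟩
      3 * B                                   ≤⟨ π-growth (s + s) s 9≤s ≤-refl ⟩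
      C                                       ∎
      where
      open ≤-Reasoning
      triple : ∀ s → s + s + s ≡ 3 * s
      triple = solve-∀
      3s≡3^[1+k] : s + s + s ≡ 3 ^ suc k
      3s≡3^[1+k] = trans (triple s) (cong (3 *_) s≡3^k)
      outside : ∀ q → 2 ^ (s + s) < q → q < suc (2 ^ (s + s + s)) → S q ≢ true
      -- A witness `i` for `q` has `2 ^ (3 ^ i) < q ≤ 2 ^ (3 ^ suc k)`, hence `i ≤ k`, and its block
      -- ends at or before x².
      outside q a<q q≤b Sq
        with i , x<q , q≤x² ← S-sound q (≤-trans (8≤2^ (m≤m+n s s)) (<⇒≤ a<q)) Sq
        = <⇒≱ a<q (begin
            q                          ≤⟨ q≤x² ⟩
            2 ^ (3 ^ i) * 2 ^ (3 ^ i)  ≡⟨ ^-distribˡ-+-* 2 (3 ^ i) (3 ^ i) ⟨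
            2 ^ (3 ^ i + 3 ^ i)        ≤⟨ ^-monoʳ-≤ 2 (+-mono-≤ 3^i≤s 3^i≤s) ⟩
            2 ^ (s + s)                ∎)
        where
        3^i<3s : 3 ^ i < s + s + s
        3^i<3s = ^-cancelˡ-< {2} (s<s z<s) (<-≤-trans x<q (s≤s⁻¹ q≤b))
        3^i≤s : 3 ^ i ≤ s
        3^i≤s = subst (3 ^ i ≤_) (sym s≡3^k)
          (^-monoʳ-≤ 3 (s≤s⁻¹ (^-cancelˡ-< {3} (s<s z<s) {i} {suc k} (subst (3 ^ i <_) 3s≡3^[1+k] 3^i<3s))))

    ratio-block : ⅔ ℚ.≤ ratio S (2 ^ (s + s))
    ratio-block with c , π≡ , r≡ ← ratio≡ S (2 ^ (s + s)) (π-positive (s + s) (≤-trans (≤-trans (m≤m+n 2 7) 9≤s) (m≤m+n s s)))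
      = subst (⅔ ℚ.≤_) (sym r≡) (mkℚᵘ-≤ (subst₂ _≤_ (cong (2 *_) π≡) (*-comm 3 S-B) count-block))

    ratio-gap : ratio S (2 ^ (s + s + s)) ℚ.≤ ⅓
    ratio-gap with c , π≡ , r≡ ← ratio≡ S (2 ^ (s + s + s)) (π-positive (s + s + s) (≤-trans (≤-trans (m≤m+n 2 7) 9≤s) (m≤n+m s (s + s))))
      = subst (ℚ._≤ ⅓) (sym r≡)
          (mkℚᵘ-≤ (subst₂ _≤_ (*-comm 3 S-C) (trans π≡ (sym (*-identityˡ (suc c)))) count-gap))

    ratio-apart : ¬ (ℚ.∣ ratio S (2 ^ (s + s)) ℚ.- ratio S (2 ^ (s + s + s)) ∣ ℚ.< ⅓)
    ratio-apart close = ℚ.<-irrefl ℚ.≃-refl (ℚ.≤-<-trans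
      (⅔≤p∧q≤⅓⇒⅓≤∣p-q∣ (ratio S (2 ^ (s + s))) (ratio S (2 ^ (s + s + s))) ratio-block ratio-gap) close)

  noDensity : ¬ HasNaturalDensity S
  noDensity density with N , cauchy ← density ⅓ (*<* (ℤ.+<+ z<s)) =
    -- The exponent `2 + N` makes `s` at least 9, as the growth estimate demands, and at least `N`,
    -- so both sample points lie beyond `N`.
    apart (3 ^ (2 + N)) refl (^-monoʳ-≤ 3 {2} {2 + N} (m≤m+n 2 N))
      (≤-trans (m≤n+m N 2) (<⇒≤ (n<m^n (s<s z<s) (2 + N))))
    where
    apart : ∀ s → s ≡ 3 ^ (2 + N) → 9 ≤ s → ¬ N ≤ s
    apart s s≡ 9≤s N≤s = ratio-apart {2 + N} s≡ 9≤s (cauchy (2 ^ (s + s)) (2 ^ (s + s + s))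
      (≤-trans N≤s (≤-trans (m≤m+n s s) (<⇒≤ (n<m^n (s<s z<s) (s + s)))))
      (≤-trans N≤s (≤-trans (m≤n+m s (s + s)) (<⇒≤ (n<m^n (s<s z<s) (s + s + s))))))

theorem8p1 : Σ Sentence λ ψ → ¬ HasNaturalDensity (Sp ψ)
theorem8p1 = ψ , noDensity (Sp⇒isPrime ψ) Sp-sound Sp-complete
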